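{- Let $t$ be a vertex of $P(G,g_0)$. If the operation $\mu_{h,f}$ (for some $h,f\in G_t$) is applicable to $t$, then $\mu_{h,f}(t)$ is a vertex of $P(G,g_0)$ adjacent to $t$. Likewise, if the operation $\mu_h$ (for some $h\in G_t$) is applicable to $t$, then $\mu_h(t)$ is a vertex of $P(G,g_0)$ adjacent to $t$.
   Context: Let $G$ be a finite abelian group of order $D$ with zero element $0$, and let $G^+=G\setminus\{0\}$. For $g_0\in G$, let $T(G,g_0)$ be the set of vectors $t=(t(g))_{g\in G^+}\in\mathbb{Z}_{\ge 0}^{G^+}$ with $\sum_{g\in G^+}t(g)g=g_0$ (sum computed in $G$), where the zero vector is excluded when $g_0=0$. The master corner polyhedron is $P(G,g_0)=\mathrm{conv}\,T(G,g_0)\subset\mathbb{R}^{G^+}$. For $t\in T(G,g_0)$ put $G_t=\{g\in G^+ : t(g)>0\}$. Two vertices are adjacent if the segment joining them is an edge (one-dimensional face) of $P(G,g_0)$. $\mu$-operations: For $t\in T(G,g_0)$ and distinct $h,f\in G_t$ with $t(h)\le t(f)$ and $h+f\neq 0$, the operation $\mu_{h,f}$ is said to be applicable to $t$, and $s=\mu_{h,f}(t)$ is defined by $s(h)=0$, $s(f)=t(f)-t(h)$, $s(h+f)=t(h+f)+t(h)$, and $s(g)=t(g)$ for all other $g\in G^+$. For $t\in T(G,g_0)$ and $h\in G_t$ with $t(h)>1$ and $t(h)h\neq 0$, the operation $\mu_h$ is applicable to $t$, and $s=\mu_h(t)$ is defined by $s(h)=0$, $s(t(h)h)=t(t(h)h)+1$,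 and $s(g)=t(g)$ for all other $g\in G^+$. -}

module Defs where

open import Level using (Level; _⊔_) renaming (suc to lsuc)
open import Algebra.Apartness.Bundles using (HeytingField; HeytingCommutativeRing)
open import Algebra.Bundles using (AbelianGroup; CommutativeRing; RawMonoid)
open import Algebra.Structures using (IsAbelianGroup)
import Algebra.Definitions.RawMonoid as RawMonoidOps
open import Data.Fin.Base using (Fin)
open import Data.Fin.Properties using (inj⇒≟)
open import Data.Irrelevant using ([_])
open import Data.Nat.Base as ℕ using (ℕ; suc)
open import Data.Product.Base using (∃-syntax; _×_; _,_)
open import Data.Refinement.Base using (Refinement-syntax; value)
open import Data.Sum.Base using (_⊎_)
open import Data.Vec.Functional using (Vector)
open import Function.Bundles using (_↔_; Inverse; _⇔_)
open import Function.Properties.Inverse using (↔⇒↣)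
open import Relation.Binary.Core using (Rel)
open import Relation.Binary.Definitions using (DecidableEquality)
open import Relation.Binary.PropositionalEquality.Core using (_≡_; _≢_)
open import Relation.Binary.Structures using (IsStrictPartialOrder)
open import Relation.Nullary.Decidable.Core using (yes; no)
open import Relation.Nullary.Negation.Core using (¬_)
open import Relation.Unary using (Pred; _∈_; _⊆_; _∩_; _≐_)

-- The library has no real numbers, so the scalars range over all ordered
-- fields.  The axioms are the constructive ones: ℚ and the Cauchy reals are
-- models, and classically (with _#_ taken to be inequality) the models are
-- exactly the usual ordered fields, ℝ among them.  1# # 0# follows from
-- the Heyting field axioms.
record OrderedField c ℓ₁ ℓ₂ ℓ₃ : Set (lsuc (c ⊔ ℓ₁ ⊔ ℓ₂ ⊔ ℓ₃)) where
  field
    heytingField : HeytingField c ℓ₁ ℓ₂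

  open HeytingField heytingField public

  commutativeRing : CommutativeRing c ℓ₁
  commutativeRing = HeytingCommutativeRing.commutativeRing heytingCommutativeRing

  open CommutativeRing commutativeRing public using (+-rawMonoid)

  infix 4 _<_ _≤_
  field
    _<_                    : Rel Carrier ℓ₃
    <-isStrictPartialOrder : IsStrictPartialOrder _≈_ _<_
    #⇔<⊎>                  : ∀ x y → (x # y) ⇔ (x < y ⊎ y < x)
    +-monoˡ-<              : ∀ z {x y} → x < y → x + z < y + z
    *-pos                  : ∀ {x y} → 0# < x → 0# < y → 0# < x * y

  _≤_ : Rel Carrier ℓ₃
  x ≤ y = ¬ (y < x)

record FiniteAbelianGroup a : Set (lsuc a) where
  infixl 6 _+_
  infix  8 -_
  field
    Carrier        : Set a
    _+_            : Carrier → Carrier → Carrier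
    0#             : Carrier
    -_             : Carrier → Carrier
    isAbelianGroup : IsAbelianGroup _≡_ _+_ 0# -_
    order          : ℕ
    enumeration    : Carrier ↔ Fin order

  abelianGroup : AbelianGroup a a
  abelianGroup = record { isAbelianGroup = isAbelianGroup }

  open AbelianGroup abelianGroup public using (rawMonoid)

  infix 4 _≟_
  _≟_ : DecidableEquality Carrier
  _≟_ = inj⇒≟ (↔⇒↣ enumeration)

  -- The proof of g ≢ 0# is irrelevant, so elements of G⁺ are equal as soon
  -- as their values are.
  G⁺ : Set a
  G⁺ = [ g ∈ Carrier ∣ g ≢ 0# ]

  module _ {m ℓ} (M : RawMonoid m ℓ) where
    private module M = RawMonoid M

    extendByε : (G⁺ → M.Carrier) → Carrier → M.Carrier
    extendByε f g with g ≟ 0#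
    ... | yes _   = M.ε
    ... | no  g≢0 = f (record { value = g ; proof = [ g≢0 ] })

    Σ⁺ : (G⁺ → M.Carrier) → M.Carrier
    Σ⁺ f = RawMonoidOps.sum M λ i → extendByε f (Inverse.from enumeration i)

module _ {a} (G : FiniteAbelianGroup a) where
  open FiniteAbelianGroup G
  open RawMonoidOps rawMonoid using () renaming (_×_ to _·_)

  T : Carrier → Pred (G⁺ → ℕ) a
  T g₀ t = Σ⁺ rawMonoid (λ g → t g · value g) ≡ g₀
         × (g₀ ≡ 0# → ¬ (∀ g → t g ≡ 0))

  Support : (G⁺ → ℕ) → Pred G⁺ _
  Support t g = 0 ℕ.< t g

  record Applicable₂ (t : G⁺ → ℕ) (h f : G⁺) : Set a where
    field
      h∈Gₜ  : h ∈ Support t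
      f∈Gₜ  : f ∈ Support t
      h≢f   : h ≢ f
      th≤tf : t h ℕ.≤ t f
      h+f≢0 : value h + value f ≢ 0#

  μ₂ : (t : G⁺ → ℕ) (h f : G⁺) → G⁺ → ℕ
  μ₂ t h f g with value g ≟ value h | value g ≟ value f | value g ≟ value h + value f
  ... | yes _ | _     | _     = 0
  ... | no _  | yes _ | _     = t f ℕ.∸ t h
  ... | no _  | no _  | yes _ = t g ℕ.+ t h
  ... | no _  | no _  | no _  = t g

  record Applicable₁ (t : G⁺ → ℕ) (h : G⁺) : Set a where
    field
      h∈Gₜ   : h ∈ Support t
      th>1   : 1 ℕ.< t h
      th·h≢0 : t h · value h ≢ 0#

  -- The defining clauses for h and for t(h)h conflict if t(h)h = h; this
  -- never happens when t is a vertex.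
  μ₁ : (t : G⁺ → ℕ) (h : G⁺) → G⁺ → ℕ
  μ₁ t h g with value g ≟ value h | value g ≟ t h · value h
  ... | yes _ | _     = 0
  ... | no _  | yes _ = t g ℕ.+ 1
  ... | no _  | no _  = t g

module _ {c ℓ₁ ℓ₂ ℓ₃ a} (K : OrderedField c ℓ₁ ℓ₂ ℓ₃) (G : FiniteAbelianGroup a) where
  open OrderedField K
  open FiniteAbelianGroup G using (G⁺; Σ⁺)
  open RawMonoidOps +-rawMonoid using (sum) renaming (_×_ to _·_)

  V : Set (a ⊔ c)
  V = G⁺ → Carrier

  infix 4 _≋_
  _≋_ : Rel V (a ⊔ ℓ₁)
  x ≋ y = ∀ g → x g ≈ y g

  ⟨_,_⟩ : V → V → Carrier
  ⟨ u , x ⟩ = Σ⁺ +-rawMonoid λ g → u g * x g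

  combination : ∀ {m} → Vector Carrier m → Vector V m → V
  combination α p g = sum λ i → α i * p i g

  ι : (G⁺ → ℕ) → V
  ι t g = t g · 1#

  conv : ∀ {ℓ} → Pred V ℓ → Pred V (a ⊔ c ⊔ ℓ₁ ⊔ ℓ₃ ⊔ ℓ)
  conv S x = ∃[ m ] ∃[ α ] ∃[ p ]
    (∀ (i : Fin m) → p i ∈ S) × (∀ i → 0# ≤ α i) × sum α ≈ 1# × x ≋ combination α p

  ιT : FiniteAbelianGroup.Carrier G → Pred V (a ⊔ ℓ₁)
  ιT g₀ x = ∃[ t ] t ∈ T G g₀ × x ≋ ι t

  P : FiniteAbelianGroup.Carrier G → Pred V (a ⊔ c ⊔ ℓ₁ ⊔ ℓ₃)
  P g₀ = conv (ιT g₀)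

  Hyperplane : V → Carrier → Pred V ℓ₁
  Hyperplane u b x = ⟨ u , x ⟩ ≈ b

  IsFace : ∀ {ℓ ℓ′} → Pred V ℓ → Pred V ℓ′ → Set (a ⊔ c ⊔ ℓ₁ ⊔ ℓ₃ ⊔ ℓ ⊔ ℓ′)
  IsFace Q F = ∃[ u ] ∃[ b ] (∀ x → x ∈ Q → b ≤ ⟨ u , x ⟩) × F ≐ (Q ∩ Hyperplane u b)

  AffinelyIndependent : ∀ {m} → Vector V m → Set (a ⊔ c ⊔ ℓ₁)
  AffinelyIndependent p =
    ∀ α → sum α ≈ 0# → combination α p ≋ (λ _ → 0#) → ∀ i → α i ≈ 0#

  AffineSpan : ∀ {m} → Vector V m → Pred V (a ⊔ c ⊔ ℓ₁)
  AffineSpan p x = ∃[ α ] sum α ≈ 1# × x ≋ combination α p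

  HasDimension : ∀ {ℓ} → Pred V ℓ → ℕ → Set (a ⊔ c ⊔ ℓ₁ ⊔ ℓ)
  HasDimension F d = ∃[ p ]
    (∀ (i : Fin (suc d)) → p i ∈ F) × AffinelyIndependent p × F ⊆ AffineSpan p

  singleton : V → Pred V (a ⊔ ℓ₁)
  singleton v x = x ≋ v

  segment : V → V → Pred V (a ⊔ c ⊔ ℓ₁ ⊔ ℓ₃)
  segment v w x = ∃[ α ] 0# ≤ α × α ≤ 1# × x ≋ (λ g → (1# - α) * v g + α * w g)

  IsVertex : ∀ {ℓ} → Pred V ℓ → V → Set (a ⊔ c ⊔ ℓ₁ ⊔ ℓ₃ ⊔ ℓ)
  IsVertex Q v = IsFace Q (singleton v) × HasDimension (singleton v) 0

  IsEdge : ∀ {ℓ ℓ′} → Pred V ℓ → Pred V ℓ′ → Set (a ⊔ c ⊔ ℓ₁ ⊔ ℓ₃ ⊔ ℓ ⊔ ℓ′)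
  IsEdge Q F = IsFace Q F × HasDimension F 1

  record Adjacent {ℓ} (Q : Pred V ℓ) (v w : V) : Set (a ⊔ c ⊔ ℓ₁ ⊔ ℓ₃ ⊔ ℓ) where
    field
      vertexˡ : IsVertex Q v
      vertexʳ : IsVertex Q w
      edge    : IsEdge Q (segment v w)

{-# OPTIONS --safe #-}
module Submission where

-- Both operations replace n copies of a multiset r by n copies of its sum q: for
-- μ_{h,f} take r = {h, f} and n = t(h); for μ_h take r = t(h) copies of h and
-- n = 1.  A vertex t is never the midpoint of two other points of T, so t(q) = 0.
-- Undoing the replacement, x ↦ x + x(q) (r − e_q), maps the polyhedron into itself
-- and collapses the segment from t to s = t − n (r − e_q) to t.  If u exposes t,
-- then u composed with this map exposes the segment, and adding the coordinate
-- x(h), which is nonnegative and on the segment vanishes only at s, exposes s.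

open import Defs
open import Data.Nat.Base using (ℕ)
open import Data.Product.Base using (_×_)
open import Relation.Unary using (_∈_)

open import Algebra.Bundles using (AbelianGroup; CommutativeMonoid; CommutativeRing)
import Algebra.Properties.AbelianGroup as AbelianGroupProperties
import Algebra.Properties.CommutativeMonoid.Sum as CommutativeMonoidSum
import Algebra.Properties.CommutativeSemigroup as CommutativeSemigroupProperties
import Algebra.Properties.Monoid.Mult as MonoidMult
import Algebra.Properties.Ring as RingProperties
import Algebra.Properties.Semiring.Mult as SemiringMult
import Algebra.Properties.Semiring.Sum as SemiringSum
open import Data.Empty using (⊥-elim-irr)
open import Data.Fin.Base using (zero; suc)
open import Data.Irrelevant using ([_])
open import Data.Nat.Base as ℕ using (zero; suc; s≤s; z≤n)
import Data.Nat.Properties as ℕ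
open import Data.Product.Base using (_,_; proj₁; proj₂)
open import Data.Refinement.Base using (value)
open import Data.Sum.Base using ([_,_]′; inj₂)
open import Data.Vec.Functional using (Vector)
open import Function.Base using (_∘_)
open import Function.Bundles using (Equivalence; Inverse)
open import Relation.Binary.Definitions using (tri<; tri≈; tri>)
open import Relation.Binary.PropositionalEquality as ≡ using (_≡_; _≢_)
import Relation.Binary.Reasoning.Setoid as SetoidReasoning
open import Relation.Binary.Structures using (IsStrictPartialOrder)
open import Relation.Nullary.Decidable.Core using (yes; no)
open import Relation.Nullary.Negation.Core using (contradiction)

-- Sums over the nonzero group elements.

module SumOverG⁺ {a m ℓ} (G : FiniteAbelianGroup a) (M : CommutativeMonoid m ℓ) where
  open FiniteAbelianGroup G using (G⁺; 0#; _≟_; enumeration; extendByε; Σ⁺)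
  open CommutativeMonoid M
  open CommutativeMonoidSum M using (sum; sum-cong-≋; ∑-distrib-+)
  open SetoidReasoning setoid

  sum-zero : ∀ {n} (v : Vector Carrier n) → (∀ i → v i ≈ ε) → sum v ≈ ε
  sum-zero {zero}  v v≈ε = refl
  sum-zero {suc n} v v≈ε =
    trans (∙-cong (v≈ε zero) (sum-zero (v ∘ suc) (v≈ε ∘ suc))) (identityˡ ε)

  sum-single : ∀ {n} (v : Vector Carrier n) i → (∀ j → j ≢ i → v j ≈ ε) → sum v ≈ v i
  sum-single v zero v≈ε =
    trans (∙-congˡ (sum-zero (v ∘ suc) λ j → v≈ε (suc j) λ ())) (identityʳ _)
  sum-single v (suc i) v≈ε =
    trans (∙-cong (v≈ε zero λ ()) (sum-single (v ∘ suc) i λ j j≢i → v≈ε (suc j) λ { ≡.refl → j≢i ≡.refl }))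
          (identityˡ _)

  Σ⁺-cong : ∀ {f f′ : G⁺ → Carrier} → (∀ g → f g ≈ f′ g) → Σ⁺ rawMonoid f ≈ Σ⁺ rawMonoid f′
  Σ⁺-cong {f} {f′} f≈f′ = sum-cong-≋ λ i → ext (Inverse.from enumeration i)
    where
    ext : ∀ c → extendByε rawMonoid f c ≈ extendByε rawMonoid f′ c
    ext c with c ≟ 0#
    ... | yes _ = refl
    ... | no _  = f≈f′ _

  Σ⁺-ε : ∀ {f : G⁺ → Carrier} → (∀ g → f g ≈ ε) → Σ⁺ rawMonoid f ≈ ε
  Σ⁺-ε {f} f≈ε = sum-zero _ λ i → ext (Inverse.from enumeration i)
    where
    ext : ∀ c → extendByε rawMonoid f c ≈ ε
    ext c with c ≟ 0#
    ... | yes _ = refl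
    ... | no _  = f≈ε _

  Σ⁺-∙ : ∀ (f f′ : G⁺ → Carrier) →
    Σ⁺ rawMonoid (λ g → f g ∙ f′ g) ≈ Σ⁺ rawMonoid f ∙ Σ⁺ rawMonoid f′
  Σ⁺-∙ f f′ = trans (sum-cong-≋ λ i → ext (Inverse.from enumeration i))
    (∑-distrib-+ (extendByε rawMonoid f ∘ Inverse.from enumeration)
                 (extendByε rawMonoid f′ ∘ Inverse.from enumeration))
    where
    ext : ∀ c → extendByε rawMonoid (λ g → f g ∙ f′ g) c
              ≈ extendByε rawMonoid f c ∙ extendByε rawMonoid f′ c
    ext c with c ≟ 0#
    ... | yes _ = sym (identityˡ ε)
    ... | no _  = refl

  -- The enumeration is a bijection, so every index other than that of `q` names either zero, whose
  -- slot holds `ε`, or another element, where `f` is `ε` by hypothesis.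
  Σ⁺-single : ∀ (f : G⁺ → Carrier) q → (∀ g → value g ≢ value q → f g ≈ ε) →
    Σ⁺ rawMonoid f ≈ f q
  Σ⁺-single f q f≈ε = begin
    Σ⁺ rawMonoid f                                    ≈⟨ sum-single _ i₀ away ⟩
    extendByε rawMonoid f (Inverse.from enumeration i₀)
      ≡⟨ ≡.cong (extendByε rawMonoid f) (Inverse.strictlyInverseʳ enumeration (value q)) ⟩
    extendByε rawMonoid f (value q)                   ≈⟨ at q ⟩
    f q ∎
    where
    i₀ = Inverse.to enumeration (value q)
    away : ∀ j → j ≢ i₀ → extendByε rawMonoid f (Inverse.from enumeration j) ≈ ε
    away j j≢i₀ with Inverse.from enumeration j ≟ 0#
    ... | yes _ = refl
    ... | no _  = f≈ε _ λ eq →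
      j≢i₀ (≡.trans (≡.sym (Inverse.strictlyInverseˡ enumeration j)) (≡.cong (Inverse.to enumeration) eq))
    at : ∀ g → extendByε rawMonoid f (value g) ≈ f g
    at record { value = v ; proof = [ v≢0 ] } with v ≟ 0#
    ... | yes v≡0 = ⊥-elim-irr (v≢0 v≡0)
    ... | no _    = refl

-- Constructive ordered field arithmetic, with `≤` read as a negated `<`.

module OrderedFieldProperties {c ℓ₁ ℓ₂ ℓ₃} (K : OrderedField c ℓ₁ ℓ₂ ℓ₃) where
  open OrderedField K hiding (zero)
  open CommutativeRing commutativeRing using (ring; semiring)
  open RingProperties ring
    using (-‿involutive; -‿distribˡ-*; -‿distribʳ-*; [y-z]x≈yx-zx; //-rightDividesˡ; //-rightDividesʳ; -0#≈0#)
  open SemiringSum semiring using (sum)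
  open SemiringMult semiring using (×-homo-+) renaming (_×_ to _·_)
  open SetoidReasoning setoid
  open IsStrictPartialOrder <-isStrictPartialOrder
    using (irrefl; <-resp-≈; asym) renaming (trans to <-trans)

  <-respʳ : ∀ {x y z} → y ≈ z → x < y → x < z
  <-respʳ = proj₁ <-resp-≈

  <-respˡ : ∀ {x y z} → x ≈ y → x < z → y < z
  <-respˡ = proj₂ <-resp-≈

  -- Apartness is tight: were `x # y`, one of the two strict inequalities would hold, and both are
  -- refuted.
  ≤-antisym : ∀ {x y} → x ≤ y → y ≤ x → x ≈ y
  ≤-antisym {x} {y} x≤y y≤x =
    proj₁ (tight x y) λ x#y → [ y≤x , x≤y ]′ (Equivalence.to (#⇔<⊎> x y) x#y)

  ≤-refl : ∀ {x y} → x ≈ y → x ≤ y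
  ≤-refl x≈y = irrefl (sym x≈y)

  ≤-respʳ : ∀ {x y z} → y ≈ z → x ≤ y → x ≤ z
  ≤-respʳ y≈z x≤y z<x = x≤y (<-respˡ (sym y≈z) z<x)

  <⇒≤ : ∀ {x y} → x < y → x ≤ y
  <⇒≤ x<y = asym x<y

  x<y⇒0<y-x : ∀ {x y} → x < y → 0# < y - x
  x<y⇒0<y-x {x} x<y = <-respˡ (-‿inverseʳ x) (+-monoˡ-< (- x) x<y)

  0<y-x⇒x<y : ∀ {x y} → 0# < y - x → x < y
  0<y-x⇒x<y {x} {y} 0<y-x =
    <-respʳ (//-rightDividesˡ x y) (<-respˡ (+-identityˡ x) (+-monoˡ-< x 0<y-x))

  +-cancelʳ-< : ∀ z {x y} → x + z < y + z → x < y
  +-cancelʳ-< z {x} {y} p =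
    <-respʳ (//-rightDividesʳ z y) (<-respˡ (//-rightDividesʳ z x) (+-monoˡ-< (- z) p))

  *-monoˡ-< : ∀ {z} → 0# < z → ∀ {x y} → x < y → x * z < y * z
  *-monoˡ-< {z} 0<z {x} {y} x<y =
    0<y-x⇒x<y (<-respʳ ([y-z]x≈yx-zx z y x) (*-pos (x<y⇒0<y-x x<y) 0<z))

  *-cancelʳ-≤ : ∀ {z} → 0# < z → ∀ {x y} → x * z ≤ y * z → x ≤ y
  *-cancelʳ-≤ 0<z xz≤yz y<x = xz≤yz (*-monoˡ-< 0<z y<x)

  *-cancelʳ-≈ : ∀ {z} → 0# < z → ∀ {x y} → x * z ≈ y * z → x ≈ y
  *-cancelʳ-≈ 0<z eq =
    ≤-antisym (*-cancelʳ-≤ 0<z (≤-refl eq)) (*-cancelʳ-≤ 0<z (≤-refl (sym eq)))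

  x≤x+z : ∀ x {z} → 0# ≤ z → x ≤ x + z
  x≤x+z x 0≤z x+z<x =
    0≤z (+-cancelʳ-< x (<-respʳ (sym (+-identityˡ x)) (<-respˡ (+-comm x _) x+z<x)))

  -- No case split on the sign of `z` is made. Assuming `y + z < x`, a positive `z` would give
  -- `y < x`; hence `z ≈ 0#`, and the assumption itself becomes `y < x`.
  x≤y⇒x≤y+z : ∀ {x y z} → x ≤ y → 0# ≤ z → x ≤ y + z
  x≤y⇒x≤y+z {x} {y} {z} x≤y 0≤z y+z<x =
    x≤y (<-respˡ (trans (+-congˡ z≈0) (+-identityʳ y)) y+z<x)
    where
    z≈0 : z ≈ 0#
    z≈0 = ≤-antisym
      (λ 0<z → x≤y (<-trans (<-respˡ (+-identityˡ y) (<-respʳ (+-comm z y) (+-monoˡ-< y 0<z))) y+z<x))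
      0≤z

  -- Used to intersect faces: when a sum of two valid inequalities is tight, each of them is tight.
  +-tight : ∀ {x y z} → x ≤ y → 0# ≤ z → y + z ≈ x → y ≈ x × z ≈ 0#
  +-tight {x} {y} {z} x≤y 0≤z y+z≈x = y≈x , ≤-antisym z≤0 0≤z
    where
    y≈x : y ≈ x
    y≈x = ≤-antisym (λ x<y → x≤x+z x 0≤z (<-respʳ y+z≈x (+-monoˡ-< z x<y))) x≤y
    z≤0 : z ≤ 0#
    z≤0 0<z = irrefl (trans y≈x (sym y+z≈x))
      (<-respʳ (+-comm z y) (<-respˡ (+-identityˡ y) (+-monoˡ-< y 0<z)))

  -- If `y` exceeded `x`, the fixed sum would push `z` below `x`.
  midpoint-tight : ∀ {x y z} → x ≤ y → x ≤ z → y + z ≈ x + x → y ≈ x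
  midpoint-tight {x} {y} {z} x≤y x≤z eq = ≤-antisym y≤x x≤y
    where
    y≤x : y ≤ x
    y≤x x<y = x≤z (+-cancelʳ-< x
      (<-respˡ (+-comm x z) (<-respʳ eq (+-monoˡ-< z x<y))))

  -- Under the assumption `x * y < 0#`, a positive `x` would rule out a positive `y` and so force
  -- `y ≈ 0#`. Thus `x ≈ 0#`, and the product is zero after all.
  *-nonneg : ∀ {x y} → 0# ≤ x → 0# ≤ y → 0# ≤ x * y
  *-nonneg {x} {y} 0≤x 0≤y xy<0 = irrefl (trans (*-congʳ x≈0) (zeroˡ y)) xy<0
    where
    x≈0 : x ≈ 0#
    x≈0 = ≤-antisym (λ 0<x → irrefl (trans (*-congˡ (≤-antisym
      (λ 0<y → asym (*-pos 0<x 0<y) xy<0) 0≤y)) (zeroʳ x)) xy<0) 0≤x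

  sum-nonneg : ∀ {n} (v : Vector Carrier n) → (∀ i → 0# ≤ v i) → 0# ≤ sum v
  sum-nonneg {zero}  v 0≤v = ≤-refl refl
  sum-nonneg {suc n} v 0≤v = x≤y⇒x≤y+z (0≤v zero) (sum-nonneg (v ∘ suc) (0≤v ∘ suc))

  invert : ∀ {x} → 0# < x → Carrier
  invert {x} 0<x = proj₁ (#⇒invertible (Equivalence.from (#⇔<⊎> x 0#) (inj₂ 0<x)))

  -- The field axiom inverts the difference `x - 0#`, which has to be turned back into `x`.
  invert-*ˡ : ∀ {x} (0<x : 0# < x) → invert 0<x * x ≈ 1#
  invert-*ˡ {x} 0<x = trans (*-congˡ (sym (trans (+-congˡ -0#≈0#) (+-identityʳ x))))
    (proj₁ (proj₂ (#⇒invertible (Equivalence.from (#⇔<⊎> x 0#) (inj₂ 0<x)))))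

  -- Being invertible, `1#` is apart from `0#`, so it is positive or negative. If it were negative,
  -- `- 1#` would be positive and so would its square, which is `1#`.
  0<1 : 0# < 1#
  0<1 = [ (λ 1<0 → contradiction 1<0 (asym (0<1′ 1<0))) , (λ p → p) ]′
    (Equivalence.to (#⇔<⊎> 1# 0#) 1#0)
    where
    1#0 : 1# # 0#
    1#0 = invertible⇒# (1# , 1-0 , trans (*-comm _ _) 1-0)
      where
      1-0 : 1# * (1# - 0#) ≈ 1#
      1-0 = trans (*-identityˡ _) (trans (+-congˡ -0#≈0#) (+-identityʳ 1#))
    0<1′ : 1# < 0# → 0# < 1#
    0<1′ 1<0 = <-respʳ sq (*-pos 0<-1 0<-1)
      where
      0<-1 : 0# < - 1#
      0<-1 = <-respʳ (+-identityˡ _) (x<y⇒0<y-x 1<0)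
      sq : - 1# * - 1# ≈ 1#
      sq = begin
        - 1# * - 1#     ≈⟨ sym (-‿distribˡ-* 1# (- 1#)) ⟩
        - (1# * - 1#)   ≈⟨ -‿cong (*-identityˡ (- 1#)) ⟩
        - - 1#          ≈⟨ -‿involutive 1# ⟩
        1#              ∎

  ·1-nonneg : ∀ n → 0# ≤ n · 1#
  ·1-nonneg zero    = ≤-refl refl
  ·1-nonneg (suc n) = x≤y⇒x≤y+z (<⇒≤ 0<1) (·1-nonneg n)

  ·1-pos : ∀ {n} → 0 ℕ.< n → 0# < n · 1#
  ·1-pos {suc n} _ = go n
    where
    go : ∀ n → 0# < suc n · 1#
    go zero    = <-respʳ (sym (+-identityʳ 1#)) 0<1
    go (suc n) = <-trans (go n) (<-respˡ (+-identityˡ _) (+-monoˡ-< (suc n · 1#) 0<1))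

  ·1-mono-< : ∀ {m n} → m ℕ.< n → m · 1# < n · 1#
  ·1-mono-< {m} {n} m<n = <-respʳ
    (trans (sym (×-homo-+ 1# (n ℕ.∸ m) m)) (reflexive (≡.cong (_· 1#) (ℕ.m∸n+n≡m (ℕ.<⇒≤ m<n)))))
    (<-respˡ (+-identityˡ _) (+-monoˡ-< (m · 1#) (·1-pos (ℕ.m<n⇒0<n∸m m<n))))

  -- An ordered field has characteristic zero; this reads an equality of lattice points over the
  -- field back as an equality of multiplicities.
  ·1-injective : ∀ {m n} → m · 1# ≈ n · 1# → m ≡ n
  ·1-injective {m} {n} eq with ℕ.<-cmp m n
  ... | tri< m<n _ _ = contradiction (·1-mono-< m<n) (irrefl eq)
  ... | tri≈ _ m≡n _ = m≡n
  ... | tri> _ _ n<m = contradiction (·1-mono-< n<m) (irrefl (sym eq))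

  -- Passes from the subtraction-free form, which is available over the natural numbers, to the form
  -- with the direction `r - d`, which exists only over the field.
  shift : ∀ {x y z r d} → x + z * d ≈ y + z * r → y + z * (r - d) ≈ x
  shift {x} {y} {z} {r} {d} eq = begin
    y + z * (r - d)           ≈⟨ +-congˡ (distribˡ z r (- d)) ⟩
    y + (z * r + z * - d)     ≈⟨ +-assoc y _ _ ⟨
    y + z * r + z * - d       ≈⟨ +-cong (sym eq) (sym (-‿distribʳ-* z d)) ⟩
    x + z * d - z * d         ≈⟨ //-rightDividesʳ (z * d) x ⟩
    x                         ∎

-- Multisets of nonzero group elements and their sums in the group.

module Multiplicities {a} (G : FiniteAbelianGroup a) where
  open FiniteAbelianGroup G renaming (_+_ to _⊕_)
  open AbelianGroup abelianGroup using (commutativeMonoid; monoid)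
  open AbelianGroupProperties abelianGroup using (∙-cancelʳ)
  open MonoidMult monoid using (×-homo-+) renaming (_×_ to _·_)
  open SumOverG⁺ G commutativeMonoid

  -- The unit vector e_q, that is, the multiset holding `q` once.
  δ : G⁺ → G⁺ → ℕ
  δ q g with value g ≟ value q
  ... | yes _ = 1
  ... | no _  = 0

  δ-≡ : ∀ {q g} → value g ≡ value q → δ q g ≡ 1
  δ-≡ {q} {g} g≡q with value g ≟ value q
  ... | yes _  = ≡.refl
  ... | no g≢q = contradiction g≡q g≢q

  δ-≢ : ∀ {q g} → value g ≢ value q → δ q g ≡ 0
  δ-≢ {q} {g} g≢q with value g ≟ value q
  ... | yes g≡q = contradiction g≡q g≢q
  ... | no _    = ≡.refl

  G⁺-≡ : ∀ {g q : G⁺} → value g ≡ value q → g ≡ q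
  G⁺-≡ {record { value = _ ; proof = [ _ ] }} {record { value = _ ; proof = [ _ ] }} ≡.refl = ≡.refl

  -- Guarantees that truncated subtraction of `k` copies of `q` is exact.
  scaled-δ-≤ : ∀ {k q} {v : G⁺ → ℕ} → k ℕ.≤ v q → ∀ g → k ℕ.* δ q g ℕ.≤ v g
  scaled-δ-≤ {k} {q} {v} k≤vq g with value g ≟ value q
  ... | no _ rewrite ℕ.*-zeroʳ k = z≤n
  ... | yes g≡q rewrite ℕ.*-identityʳ k | G⁺-≡ {g} {q} g≡q = k≤vq

  total : (G⁺ → ℕ) → Carrier
  total v = Σ⁺ rawMonoid λ g → v g · value g

  total-cong : ∀ {v v′} → (∀ g → v g ≡ v′ g) → total v ≡ total v′
  total-cong v≡v′ = Σ⁺-cong λ g → ≡.cong (_· value g) (v≡v′ g)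

  total-+ : ∀ v v′ → total (λ g → v g ℕ.+ v′ g) ≡ total v ⊕ total v′
  total-+ v v′ = ≡.trans (Σ⁺-cong λ g → ×-homo-+ (value g) (v g) (v′ g))
    (Σ⁺-∙ (λ g → v g · value g) (λ g → v′ g · value g))

  total-* : ∀ n v → total (λ g → n ℕ.* v g) ≡ n · total v
  total-* zero    v = Σ⁺-ε λ _ → ≡.refl
  total-* (suc n) v = ≡.trans (total-+ v (λ g → n ℕ.* v g)) (≡.cong (total v ⊕_) (total-* n v))

  total-δ : ∀ q → total (δ q) ≡ value q
  total-δ q = ≡.trans
    (Σ⁺-single (λ g → δ q g · value g) q λ g g≢q → ≡.cong (_· value g) (δ-≢ g≢q))
    (≡.trans (≡.cong (_· value q) (δ-≡ ≡.refl)) (AbelianGroup.identityʳ abelianGroup _))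

  -- Both sides of the balance equation have equal sums, and the common term `n · total r` cancels
  -- in the group. The balance is stated with additions only, so that truncated subtraction does not
  -- enter.
  total-exchange : ∀ {v v′ r r′} n → total r ≡ total r′ →
    (∀ g → v g ℕ.+ n ℕ.* r g ≡ v′ g ℕ.+ n ℕ.* r′ g) → total v ≡ total v′
  total-exchange {v} {v′} {r} {r′} n r≡r′ eq = ∙-cancelʳ (n · total r) _ _ (begin
    total v ⊕ n · total r                  ≡⟨ ≡.cong (total v ⊕_) (total-* n r) ⟨
    total v ⊕ total (λ g → n ℕ.* r g)      ≡⟨ total-+ v _ ⟨
    total (λ g → v g ℕ.+ n ℕ.* r g)        ≡⟨ total-cong eq ⟩
    total (λ g → v′ g ℕ.+ n ℕ.* r′ g)      ≡⟨ total-+ v′ _ ⟩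
    total v′ ⊕ total (λ g → n ℕ.* r′ g)    ≡⟨ ≡.cong (total v′ ⊕_) (total-* n r′) ⟩
    total v′ ⊕ n · total r′                ≡⟨ ≡.cong (λ y → total v′ ⊕ n · y) r≡r′ ⟨
    total v′ ⊕ n · total r                 ∎)
    where open ≡.≡-Reasoning

-- Linear functionals, convex hulls and the faces produced by collapsing.

module PolyhedronGeometry {c ℓ₁ ℓ₂ ℓ₃ a} (K : OrderedField c ℓ₁ ℓ₂ ℓ₃) (G : FiniteAbelianGroup a) where
  open OrderedField K hiding (zero)
  open OrderedFieldProperties K
  open CommutativeRing commutativeRing using (ring; semiring; +-commutativeMonoid)
  open FiniteAbelianGroup G using (G⁺; Σ⁺; extendByε; enumeration) renaming (_≟_ to _≟ᴳ_; 0# to 0ᴳ)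
  open Multiplicities G
  open SumOverG⁺ G +-commutativeMonoid
  open SemiringSum semiring using (sum; sum-cong-≋; ∑-distrib-+; *-distribˡ-sum; *-distribʳ-sum)
  open SemiringMult semiring using () renaming (_×_ to _·_)
  open RingProperties ring using (//-rightDividesˡ; -0#≈0#; +-cancelʳ)
  open SetoidReasoning setoid

  Point = V K G
  ⟪_,_⟫ = ⟨_,_⟩ K G

  pairing-congʳ : ∀ u {x y : Point} → (∀ g → x g ≈ y g) → ⟪ u , x ⟫ ≈ ⟪ u , y ⟫
  pairing-congʳ u x≈y = Σ⁺-cong λ g → *-congˡ (x≈y g)

  Σ⁺-*ˡ : ∀ k (f : G⁺ → Carrier) → Σ⁺ +-rawMonoid (λ g → k * f g) ≈ k * Σ⁺ +-rawMonoid f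
  Σ⁺-*ˡ k f = trans (sum-cong-≋ λ i → ext (Inverse.from enumeration i))
    (sym (*-distribˡ-sum k (extendByε +-rawMonoid f ∘ Inverse.from enumeration)))
    where
    ext : ∀ d → extendByε +-rawMonoid (λ g → k * f g) d ≈ k * extendByε +-rawMonoid f d
    ext d with d ≟ᴳ 0ᴳ
    ... | yes _ = sym (zeroʳ k)
    ... | no _  = refl

  pairing-+ʳ : ∀ u (x y : Point) → ⟪ u , (λ g → x g + y g) ⟫ ≈ ⟪ u , x ⟫ + ⟪ u , y ⟫
  pairing-+ʳ u x y =
    trans (Σ⁺-cong λ g → distribˡ (u g) (x g) (y g)) (Σ⁺-∙ (λ g → u g * x g) (λ g → u g * y g))

  pairing-shift : ∀ u (x w : Point) k → ⟪ u , (λ g → x g + k * w g) ⟫ ≈ ⟪ u , x ⟫ + k * ⟪ u , w ⟫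
  pairing-shift u x w k = trans (pairing-+ʳ u x (λ g → k * w g)) (+-congˡ (trans
    (Σ⁺-cong λ g → trans (sym (*-assoc _ _ _)) (trans (*-congʳ (*-comm (u g) k)) (*-assoc _ _ _)))
    (Σ⁺-*ˡ k (λ g → u g * w g))))

  perturb : Point → Carrier → G⁺ → Point
  perturb u k q g = u g + k * ι K G (δ q) g

  -- Pairing with the unit vector at `q` is the coordinate functional: in the second part of the
  -- distributed sum only the term at `q` survives.
  pairing-perturb : ∀ u k q (x : Point) → ⟪ perturb u k q , x ⟫ ≈ ⟪ u , x ⟫ + k * x q
  pairing-perturb u k q x = begin
    ⟪ perturb u k q , x ⟫
      ≈⟨ Σ⁺-cong (λ g → distribʳ (x g) (u g) _) ⟩
    Σ⁺ +-rawMonoid (λ g → u g * x g + k * (δ q g · 1#) * x g)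
      ≈⟨ Σ⁺-∙ (λ g → u g * x g) (λ g → k * (δ q g · 1#) * x g) ⟩
    ⟪ u , x ⟫ + Σ⁺ +-rawMonoid (λ g → k * (δ q g · 1#) * x g)
      ≈⟨ +-congˡ (Σ⁺-single (λ g → k * (δ q g · 1#) * x g) q away) ⟩
    ⟪ u , x ⟫ + k * (δ q q · 1#) * x q
      ≈⟨ +-congˡ (*-congʳ (trans (*-congˡ at) (*-identityʳ k))) ⟩
    ⟪ u , x ⟫ + k * x q ∎
    where
    at : δ q q · 1# ≈ 1#
    at rewrite δ-≡ {q} {q} ≡.refl = +-identityʳ 1#
    away : ∀ g → value g ≢ value q → k * (δ q g · 1#) * x g ≈ 0#
    away g g≢q rewrite δ-≢ {q} {g} g≢q = trans (*-congʳ (zeroʳ k)) (zeroˡ (x g))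

  singleton-dimension : ∀ v → HasDimension K G (singleton K G v) 0
  singleton-dimension v = (λ _ → v) , (λ _ _ → refl)
    , (λ { α Σα≈0 _ zero → trans (sym (+-identityʳ (α zero))) Σα≈0 })
    , (λ x≈v → (λ _ → 1#) , +-identityʳ 1# ,
        λ g → trans (x≈v g) (sym (trans (+-identityʳ _) (*-identityˡ (v g)))))

  ⊆conv : ∀ {ℓ} {S : Point → Set ℓ} {x} → x ∈ S → x ∈ conv K G S
  ⊆conv {x = x} x∈S = 1 , (λ _ → 1#) , (λ _ → x) , (λ _ → x∈S) , (λ _ → <⇒≤ 0<1)
    , +-identityʳ 1# , λ g → sym (trans (+-identityʳ _) (*-identityˡ (x g)))

  segment⊆conv : ∀ {ℓ} {S : Point → Set ℓ} {v w x} → v ∈ S → w ∈ S →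
    x ∈ segment K G v w → x ∈ conv K G S
  segment⊆conv {v = v} {w} v∈S w∈S (α , 0≤α , α≤1 , x≈) =
    2 , (λ { zero → 1# - α ; (suc _) → α }) , (λ { zero → v ; (suc _) → w })
    , (λ { zero → v∈S ; (suc _) → w∈S }) , (λ { zero → 0≤1-α ; (suc _) → 0≤α })
    , trans (+-congˡ (+-identityʳ α)) (//-rightDividesˡ α 1#)
    , λ g → trans (x≈ g) (+-congˡ (sym (+-identityʳ _)))
    where
    0≤1-α : 0# ≤ 1# - α
    0≤1-α p = α≤1 (<-respˡ (//-rightDividesˡ α 1#) (<-respʳ (+-identityˡ α) (+-monoˡ-< α p)))

  -- The map is linear, because `x q` is a linear function of `x`; so it commutes with convex
  -- combinations and can be applied to the points `p i` with the same weights.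
  conv-map : ∀ {ℓ} {S : Point → Set ℓ} (w : Point) q →
    (∀ x → x ∈ S → (λ g → x g + x q * w g) ∈ S) →
    ∀ x → x ∈ conv K G S → (λ g → x g + x q * w g) ∈ conv K G S
  conv-map w q S→S x (m , α , p , p∈S , 0≤α , Σα≈1 , x≈) =
    m , α , (λ i g → p i g + p i q * w g) , (λ i → S→S (p i) (p∈S i)) , 0≤α , Σα≈1 , λ g → begin
      x g + x q * w g
        ≈⟨ +-cong (x≈ g) (*-congʳ (x≈ q)) ⟩
      sum (λ i → α i * p i g) + sum (λ i → α i * p i q) * w g
        ≈⟨ +-congˡ (*-distribʳ-sum (w g) (λ i → α i * p i q)) ⟩
      sum (λ i → α i * p i g) + sum (λ i → α i * p i q * w g)
        ≈⟨ ∑-distrib-+ (λ i → α i * p i g) (λ i → α i * p i q * w g) ⟨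
      sum (λ i → α i * p i g + α i * p i q * w g)
        ≈⟨ sum-cong-≋ {m} (λ i → trans (distribˡ _ _ _) (+-congˡ (sym (*-assoc _ _ _)))) ⟨
      sum (λ i → α i * (p i g + p i q * w g)) ∎

  conv-nonneg : ∀ {ℓ} {S : Point → Set ℓ} → (∀ x → x ∈ S → ∀ g → 0# ≤ x g) →
    ∀ x → x ∈ conv K G S → ∀ g → 0# ≤ x g
  conv-nonneg 0≤S x (m , α , p , p∈S , 0≤α , _ , x≈) g =
    ≤-respʳ (sym (x≈ g)) (sum-nonneg _ λ i → *-nonneg (0≤α i) (0≤S (p i) (p∈S i) g))

  conv-resp : ∀ {ℓ} {S : Point → Set ℓ} {x y} → (∀ g → x g ≈ y g) → y ∈ conv K G S → x ∈ conv K G S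
  conv-resp x≈y (m , α , p , p∈S , 0≤α , Σα≈1 , y≈) =
    m , α , p , p∈S , 0≤α , Σα≈1 , λ g → trans (x≈y g) (y≈ g)

  startpoint∈segment : ∀ v w → v ∈ segment K G v w
  startpoint∈segment v w = 0# , ≤-refl refl , <⇒≤ 0<1 , λ g → sym (trans
    (+-cong (trans (*-congʳ (trans (+-congˡ -0#≈0#) (+-identityʳ 1#))) (*-identityˡ (v g))) (zeroˡ (w g)))
    (+-identityʳ (v g)))

  endpoint∈segment : ∀ v w → w ∈ segment K G v w
  endpoint∈segment v w = 1# , <⇒≤ 0<1 , ≤-refl refl , λ g → sym (trans
    (+-cong (trans (*-congʳ (-‿inverseʳ 1#)) (zeroˡ (v g))) (*-identityˡ (w g)))
    (+-identityˡ (w g)))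

  -- Affine independence is read off at the coordinate `q`: only `w` contributes there, so its
  -- coefficient vanishes, and the other one follows since the two sum to zero.
  segment-dimension : ∀ {v w q} → v q ≈ 0# → 0# < w q → HasDimension K G (segment K G v w) 1
  segment-dimension {v} {w} {q} vq≈0 0<wq = p
    , (λ { zero → startpoint∈segment v w ; (suc zero) → endpoint∈segment v w })
    , independent
    , λ { (α , _ , _ , x≈) → (λ { zero → 1# - α ; (suc _) → α })
        , trans (+-congˡ (+-identityʳ α)) (//-rightDividesˡ α 1#)
        , λ g → trans (x≈ g) (+-congˡ (sym (+-identityʳ _))) }
    where
    p : Vector Point 2
    p zero    = v
    p (suc _) = w
    independent : AffinelyIndependent K G p
    independent α Σα≈0 Σαp≈0 = λ { zero → α₀≈0 ; (suc zero) → α₁≈0 }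
      where
      α₁≈0 : α (suc zero) ≈ 0#
      α₁≈0 = *-cancelʳ-≈ 0<wq (begin
        α (suc zero) * w q                                ≈⟨ trans (+-identityˡ _) (+-identityʳ _) ⟨
        0# + (α (suc zero) * w q + 0#)                    ≈⟨ +-congʳ (trans (*-congˡ vq≈0) (zeroʳ _)) ⟨
        α zero * v q + (α (suc zero) * w q + 0#)          ≈⟨ Σαp≈0 q ⟩
        0#                                                ≈⟨ zeroˡ (w q) ⟨
        0# * w q                                          ∎)
      α₀≈0 : α zero ≈ 0#
      α₀≈0 = trans (sym (trans (+-congˡ (trans (+-identityʳ _) α₁≈0)) (+-identityʳ _))) Σα≈0

  -- Here `w` stands for r - e_q, `n` for the number of replaced copies and `ρ` for r(h). The
  -- equation `t h ≈ n * ρ` says that the replacement uses up `h` entirely, which is what makes the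
  -- segment end at `s`.
  collapse⇒adjacent : ∀ {ℓ} {S : Point → Set ℓ} (q h : G⁺) (w t s : Point) {n ρ} →
    (∀ x → x ∈ S → ∀ g → 0# ≤ x g) →
    (∀ x → x ∈ S → (λ g → x g + x q * w g) ∈ S) →
    t ∈ S → s ∈ S → 0# < n → 0# < ρ →
    t q ≈ 0# → s q ≈ n → (∀ g → s g + n * w g ≈ t g) → w h ≈ ρ → t h ≈ n * ρ →
    IsVertex K G (conv K G S) t →
    IsVertex K G (conv K G S) s × Adjacent K G (conv K G S) t s
  collapse⇒adjacent {S = S} q h w t s {n} {ρ} 0≤S S→S t∈S s∈S 0<n 0<ρ tq≈0 sq≈n s+nw≈t wh≈ρ th≈nρ
    t-vertex@((u , b , b≤u , t⊆face , face⊆t) , _) =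
    s-vertex , record
      { vertexˡ = t-vertex
      ; vertexʳ = s-vertex
      ; edge    = (u′ , b , b≤u′ , segment⊆face , face⊆segment)
                , segment-dimension tq≈0 (<-respʳ (sym sq≈n) 0<n)
      }
    where
    Q = conv K G S

    collapse : Point → Point
    collapse x g = x g + x q * w g

    collapse-Q : ∀ x → x ∈ Q → collapse x ∈ Q
    collapse-Q = conv-map w q S→S

    0≤Q : ∀ x → x ∈ Q → ∀ g → 0# ≤ x g
    0≤Q = conv-nonneg 0≤S

    -- Collapsing changes the value of `u` at `x` by `x q * ⟪ u , w ⟫`, so `u′` is `u` composed with
    -- `collapse`. Adding the coordinate at `h` then gives `u″`, which singles out `s` on the face
    -- of `u′`.
    u′ u″ : Point
    u′ = perturb u ⟪ u , w ⟫ q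
    u″ = perturb u′ 1# h

    u′-collapse : ∀ x → ⟪ u′ , x ⟫ ≈ ⟪ u , collapse x ⟫
    u′-collapse x = begin
      ⟪ u′ , x ⟫                       ≈⟨ pairing-perturb u ⟪ u , w ⟫ q x ⟩
      ⟪ u , x ⟫ + ⟪ u , w ⟫ * x q      ≈⟨ +-congˡ (*-comm _ _) ⟩
      ⟪ u , x ⟫ + x q * ⟪ u , w ⟫      ≈⟨ pairing-shift u x w (x q) ⟨
      ⟪ u , collapse x ⟫               ∎

    b≤u′ : ∀ x → x ∈ Q → b ≤ ⟪ u′ , x ⟫
    b≤u′ x x∈Q = ≤-respʳ (sym (u′-collapse x)) (b≤u (collapse x) (collapse-Q x x∈Q))

    u′-tight : ∀ {x} → x ∈ Q → ⟪ u′ , x ⟫ ≈ b → ∀ g → collapse x g ≈ t g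
    u′-tight {x} x∈Q eq = face⊆t (collapse-Q x x∈Q , trans (sym (u′-collapse x)) eq)

    collapsed : ∀ {x} → (∀ g → collapse x g ≈ t g) → ⟪ u′ , x ⟫ ≈ b
    collapsed {x} eq = trans (u′-collapse x)
      (trans (pairing-congʳ u eq) (proj₂ (t⊆face (λ _ → refl))))

    mix : Carrier → Point
    mix α g = (1# - α) * t g + α * s g

    -- By `mix-q` the factor `α * n` is the coordinate of the mixture at `q`, so the left side is
    -- its collapse: the whole line through `t` and `s` collapses to `t`.
    mix-collapse : ∀ α g → mix α g + α * n * w g ≈ t g
    mix-collapse α g = begin
      (1# - α) * t g + α * s g + α * n * w g      ≈⟨ +-assoc _ _ _ ⟩
      (1# - α) * t g + (α * s g + α * n * w g)    ≈⟨ +-congˡ (+-congˡ (*-assoc α n (w g))) ⟩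
      (1# - α) * t g + (α * s g + α * (n * w g))  ≈⟨ +-congˡ (distribˡ α (s g) (n * w g)) ⟨
      (1# - α) * t g + α * (s g + n * w g)        ≈⟨ +-congˡ (*-congˡ (s+nw≈t g)) ⟩
      (1# - α) * t g + α * t g                    ≈⟨ distribʳ (t g) (1# - α) α ⟨
      (1# - α + α) * t g                          ≈⟨ *-congʳ (//-rightDividesˡ α 1#) ⟩
      1# * t g                                    ≈⟨ *-identityˡ (t g) ⟩
      t g                                         ∎

    mix-q : ∀ α → mix α q ≈ α * n
    mix-q α = trans (+-cong (trans (*-congˡ tq≈0) (zeroʳ _)) (*-congˡ sq≈n)) (+-identityˡ _)

    segment⊆face : ∀ {x} → x ∈ segment K G t s → x ∈ Q × ⟪ u′ , x ⟫ ≈ b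
    segment⊆face {x} x∈seg@(α , _ , _ , x≈) = segment⊆conv t∈S s∈S x∈seg
      , collapsed λ g → trans
          (+-cong (x≈ g) (*-congʳ (trans (x≈ q) (mix-q α))))
          (mix-collapse α g)

    face⊆segment : ∀ {x} → x ∈ Q × ⟪ u′ , x ⟫ ≈ b → x ∈ segment K G t s
    face⊆segment {x} (x∈Q , eq) = α
      , *-cancelʳ-≤ 0<n (≤-respʳ (sym αn≈xq) λ xq<0n → 0≤Q x x∈Q q (<-respʳ (zeroˡ n) xq<0n))
      , *-cancelʳ-≤ 0<n αn≤n
      , λ g → +-cancelʳ _ _ _ (begin
          x g + x q * w g             ≈⟨ u′-tight x∈Q eq g ⟩
          t g                         ≈⟨ mix-collapse α g ⟨
          mix α g + α * n * w g       ≈⟨ +-congˡ (*-congʳ αn≈xq) ⟩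
          mix α g + x q * w g         ∎)
      where
      -- The coordinate at `q` grows from zero at `t` to `n` at `s`, so it determines the parameter
      -- on the segment.
      α = x q * invert 0<n
      αn≈xq : α * n ≈ x q
      αn≈xq = trans (*-assoc _ _ _) (trans (*-congˡ (invert-*ˡ 0<n)) (*-identityʳ (x q)))
      xqρ+xh≈nρ : x q * ρ + x h ≈ n * ρ
      xqρ+xh≈nρ = begin
        x q * ρ + x h      ≈⟨ +-comm _ _ ⟩
        x h + x q * ρ      ≈⟨ +-congˡ (*-congˡ wh≈ρ) ⟨
        collapse x h       ≈⟨ u′-tight x∈Q eq h ⟩
        t h                ≈⟨ th≈nρ ⟩
        n * ρ              ∎
      -- The bound `α ≤ 1#` comes from the coordinate at `h`: since `x h` is nonnegative, `x q * ρ`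
      -- is at most `n * ρ`.
      αn≤n : α * n ≤ 1# * n
      αn≤n p = *-cancelʳ-≤ 0<ρ
        (≤-respʳ xqρ+xh≈nρ (x≤x+z (x q * ρ) (0≤Q x x∈Q h)))
        (<-respˡ (*-identityˡ n) (<-respʳ αn≈xq p))

    sh≈0 : s h ≈ 0#
    sh≈0 = +-cancelʳ (n * ρ) _ _ (begin
      s h + n * ρ      ≈⟨ +-congˡ (*-congˡ wh≈ρ) ⟨
      s h + n * w h    ≈⟨ s+nw≈t h ⟩
      t h              ≈⟨ th≈nρ ⟩
      n * ρ            ≈⟨ +-identityˡ _ ⟨
      0# + n * ρ       ∎)

    0≤1x : ∀ x → x ∈ Q → 0# ≤ 1# * x h
    0≤1x x x∈Q = ≤-respʳ (sym (*-identityˡ (x h))) (0≤Q x x∈Q h)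

    s-face⊆ : ∀ {x} → x ∈ singleton K G s → x ∈ Q × ⟪ u″ , x ⟫ ≈ b
    s-face⊆ {x} x≈s = conv-resp {S = S} x≈s (⊆conv {S = S} s∈S) , (begin
      ⟪ u″ , x ⟫                ≈⟨ pairing-perturb u′ 1# h x ⟩
      ⟪ u′ , x ⟫ + 1# * x h
        ≈⟨ +-cong (collapsed λ g → trans (+-cong (x≈s g) (*-congʳ (trans (x≈s q) sq≈n))) (s+nw≈t g))
                  (trans (*-identityˡ (x h)) (trans (x≈s h) sh≈0)) ⟩
      b + 0#                    ≈⟨ +-identityʳ b ⟩
      b                         ∎)

    s-face⊇ : ∀ {x} → x ∈ Q × ⟪ u″ , x ⟫ ≈ b → x ∈ singleton K G s
    s-face⊇ {x} (x∈Q , eq) g = +-cancelʳ (n * w g) _ _ (begin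
      x g + n * w g      ≈⟨ +-congˡ (*-congʳ xq≈n) ⟨
      collapse x g       ≈⟨ u′-tight x∈Q (proj₁ split) g ⟩
      t g                ≈⟨ s+nw≈t g ⟨
      s g + n * w g      ∎)
      where
      -- Tightness of `u″` splits into tightness of `u′` and vanishing of the coordinate at `h`. The
      -- latter forces `x q ≈ n`, and then `x` is recovered from its collapse `t`.
      split : ⟪ u′ , x ⟫ ≈ b × 1# * x h ≈ 0#
      split = +-tight (b≤u′ x x∈Q) (0≤1x x x∈Q) (trans (sym (pairing-perturb u′ 1# h x)) eq)
      xq≈n : x q ≈ n
      xq≈n = *-cancelʳ-≈ 0<ρ (begin
        x q * ρ            ≈⟨ +-identityˡ _ ⟨
        0# + x q * ρ       ≈⟨ +-cong (trans (sym (*-identityˡ (x h))) (proj₂ split)) (*-congˡ wh≈ρ) ⟨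
        collapse x h       ≈⟨ u′-tight x∈Q (proj₁ split) h ⟩
        t h                ≈⟨ th≈nρ ⟩
        n * ρ              ∎)

    s-vertex : IsVertex K G Q s
    s-vertex =
      (u″ , b
        , (λ x x∈Q → ≤-respʳ (sym (pairing-perturb u′ 1# h x)) (x≤y⇒x≤y+z (b≤u′ x x∈Q) (0≤1x x x∈Q)))
        , s-face⊆ , s-face⊇)
      , singleton-dimension s

-- Replacing a multiset by its sum at a vertex.

module VertexExchange {c ℓ₁ ℓ₂ ℓ₃ a} (K : OrderedField c ℓ₁ ℓ₂ ℓ₃) (G : FiniteAbelianGroup a)
  (g₀ : FiniteAbelianGroup.Carrier G) where
  open OrderedField K hiding (zero)
  open OrderedFieldProperties K
  open CommutativeRing commutativeRing using (semiring)
  open FiniteAbelianGroup G using (G⁺)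
  open Multiplicities G
  open SemiringMult semiring using (×-homo-+; ×1-homo-*) renaming (_×_ to _·_)
  open PolyhedronGeometry K G
  open SetoidReasoning setoid

  ιT-nonneg : ∀ x → x ∈ ιT K G g₀ → ∀ g → 0# ≤ x g
  ιT-nonneg x (v , _ , x≈v) g = ≤-respʳ (sym (x≈v g)) (·1-nonneg (v g))

  ·1-cong-+* : ∀ {x y z d r} → x ℕ.+ z ℕ.* d ≡ y ℕ.+ z ℕ.* r →
    x · 1# + z · 1# * (d · 1#) ≈ y · 1# + z · 1# * (r · 1#)
  ·1-cong-+* {x} {y} {z} {d} {r} eq = begin
    x · 1# + z · 1# * (d · 1#)    ≈⟨ expand x d ⟨
    (x ℕ.+ z ℕ.* d) · 1#          ≡⟨ ≡.cong (_· 1#) eq ⟩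
    (y ℕ.+ z ℕ.* r) · 1#          ≈⟨ expand y r ⟩
    y · 1# + z · 1# * (r · 1#)    ∎
    where
    expand : ∀ x d → (x ℕ.+ z ℕ.* d) · 1# ≈ x · 1# + z · 1# * (d · 1#)
    expand x d = trans (×-homo-+ 1# x (z ℕ.* d)) (+-congˡ (×1-homo-* z d))

  -- The functional exposing `t` is at least `b` at `x` and at `y`, and its two values add up to
  -- `b + b`. So it equals `b` at `x`, which therefore lies on the face consisting of `t` alone.
  vertex-midpoint : ∀ {t x y} → IsVertex K G (P K G g₀) (ι K G t) →
    x ∈ T G g₀ → y ∈ T G g₀ → (∀ g → x g ℕ.+ y g ≡ t g ℕ.+ t g) → ∀ g → x g ≡ t g
  vertex-midpoint {t} {x} {y} ((u , b , b≤u , t⊆face , face⊆t) , _) x∈T y∈T x+y≡2t g =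
    ·1-injective (face⊆t (ι∈P x∈T , midpoint-tight (b≤u _ (ι∈P x∈T)) (b≤u _ (ι∈P y∈T)) sum≈2b) g)
    where
    ι∈P : ∀ {v} → v ∈ T G g₀ → ι K G v ∈ P K G g₀
    ι∈P v∈T = ⊆conv {S = ιT K G g₀} (_ , v∈T , λ _ → refl)
    ut≈b = proj₂ (t⊆face (λ _ → refl))
    sum≈2b : ⟪ u , ι K G x ⟫ + ⟪ u , ι K G y ⟫ ≈ b + b
    sum≈2b = begin
      ⟪ u , ι K G x ⟫ + ⟪ u , ι K G y ⟫
        ≈⟨ pairing-+ʳ u (ι K G x) (ι K G y) ⟨
      ⟪ u , (λ g → x g · 1# + y g · 1#) ⟫
        ≈⟨ pairing-congʳ u (λ g → trans (sym (×-homo-+ 1# (x g) (y g)))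
             (trans (reflexive (≡.cong (_· 1#) (x+y≡2t g))) (×-homo-+ 1# (t g) (t g)))) ⟩
      ⟪ u , (λ g → t g · 1# + t g · 1#) ⟫
        ≈⟨ pairing-+ʳ u (ι K G t) (ι K G t) ⟩
      ⟪ u , ι K G t ⟫ + ⟪ u , ι K G t ⟫
        ≈⟨ +-cong ut≈b ut≈b ⟩
      b + b ∎

  -- Otherwise the vertex t would be the midpoint of t + r − δ q and t − r + δ q.
  vertex-absent : ∀ {t r} q h → t ∈ T G g₀ → IsVertex K G (P K G g₀) (ι K G t) →
    total r ≡ value q → (∀ g → r g ℕ.≤ t g) → 0 ℕ.< r h → r h ≢ δ q h → t q ≡ 0
  vertex-absent {t} {r} q h (Σt≡g₀ , _) t-vertex Σr≡q r≤t 0<rh rh≢δ with t q in tq≡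
  ... | zero  = ≡.refl
  -- The midpoint property gives `x h ≡ t h`; cancelling `t h` in `x+δ≡t+r` leaves `r h ≡ δ q h`.
  ... | suc _ = contradiction (ℕ.+-cancelˡ-≡ (t h) _ _ (≡.trans (≡.sym (x+δ≡t+r h))
                  (≡.cong (ℕ._+ δ q h) (vertex-midpoint {t} t-vertex x∈T y∈T x+y≡2t h)))) rh≢δ
    where
    δ≤t : ∀ g → δ q g ℕ.≤ t g
    δ≤t g = ≡.subst (ℕ._≤ t g) (ℕ.*-identityˡ (δ q g))
      (scaled-δ-≤ {v = t} (≡.subst (1 ℕ.≤_) (≡.sym tq≡) (s≤s z≤n)) g)
    x y : G⁺ → ℕ
    x g = t g ℕ.+ r g ℕ.∸ δ q g
    y g = t g ℕ.+ δ q g ℕ.∸ r g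
    x+δ≡t+r : ∀ g → x g ℕ.+ δ q g ≡ t g ℕ.+ r g
    x+δ≡t+r g = ℕ.m∸n+n≡m (ℕ.m≤n⇒m≤n+o (r g) (δ≤t g))
    y+r≡t+δ : ∀ g → y g ℕ.+ r g ≡ t g ℕ.+ δ q g
    y+r≡t+δ g = ℕ.m∸n+n≡m (ℕ.m≤n⇒m≤n+o (δ q g) (r≤t g))
    x+y≡2t : ∀ g → x g ℕ.+ y g ≡ t g ℕ.+ t g
    x+y≡2t g = ℕ.+-cancelʳ-≡ (δ q g ℕ.+ r g) _ _ (≡.trans (interchange (x g) (y g) (δ q g) (r g))
      (≡.trans (≡.cong₂ ℕ._+_ (x+δ≡t+r g) (y+r≡t+δ g))
        (≡.trans (interchange (t g) (r g) (t g) (δ q g))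
          (≡.cong (t g ℕ.+ t g ℕ.+_) (ℕ.+-comm (r g) (δ q g))))))
      where open CommutativeSemigroupProperties ℕ.+-commutativeSemigroup using (interchange)
    -- Keeps the two outer points away from the excluded zero vector: `x` is nonzero at `h`, where
    -- `r` is positive, and `y` is nonzero at `q`, where `δ q` is.
    nonzero : ∀ {m n k o} → m ℕ.+ k ≡ n ℕ.+ o → k ℕ.≤ n → 0 ℕ.< o → m ≢ 0
    nonzero {n = n} {o = o} eq k≤n 0<o ≡.refl = ℕ.<⇒≱ (ℕ.m<m+n n 0<o) (≡.subst (ℕ._≤ n) eq k≤n)
    Σr≡Σδ : total r ≡ total (δ q)
    Σr≡Σδ = ≡.trans Σr≡q (≡.sym (total-δ q))
    once : ∀ {m n k o} → m ℕ.+ k ≡ n ℕ.+ o → m ℕ.+ 1 ℕ.* k ≡ n ℕ.+ 1 ℕ.* o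
    once {m} {n} {k} {o} eq rewrite ℕ.*-identityˡ k | ℕ.*-identityˡ o = eq
    x∈T : x ∈ T G g₀
    x∈T = ≡.trans (total-exchange {x} {t} 1 (≡.sym Σr≡Σδ) (λ g → once {x g} {t g} (x+δ≡t+r g))) Σt≡g₀
      , λ _ x≡0 → nonzero {x h} (x+δ≡t+r h) (δ≤t h) 0<rh (x≡0 h)
    y∈T : y ∈ T G g₀
    y∈T = ≡.trans (total-exchange {y} {t} 1 Σr≡Σδ (λ g → once {y g} {t g} (y+r≡t+δ g))) Σt≡g₀
      , λ _ y≡0 → nonzero {y q} (y+r≡t+δ q) (r≤t q)
          (≡.subst (0 ℕ.<_) (≡.sym (δ-≡ {q} {q} ≡.refl)) (s≤s z≤n)) (y≡0 q)

  -- The common core of both operations: it checks that the collapse along r - e_q preserves the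
  -- lattice points in `T` and that `s` is one of them, and then applies `collapse⇒adjacent`.
  exchange : ∀ {t s r} q h n → t ∈ T G g₀ → IsVertex K G (P K G g₀) (ι K G t) →
    total r ≡ value q → 0 ℕ.< n → 0 ℕ.< r h → n ℕ.* r h ≡ t h → (∀ g → r g ℕ.≤ t g) → t q ≡ 0 →
    (∀ g → s g ℕ.+ n ℕ.* r g ≡ t g ℕ.+ n ℕ.* δ q g) →
    IsVertex K G (P K G g₀) (ι K G s) × Adjacent K G (P K G g₀) (ι K G t) (ι K G s)
  exchange {t} {s} {r} q h n t∈T@(Σt≡g₀ , _) t-vertex Σr≡q 0<n 0<rh nrh≡th r≤t tq≡0 s+nr≡t+nδ =
    collapse⇒adjacent q h w (ι K G t) (ι K G s) ιT-nonneg collapse-ιT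
      (t , t∈T , λ _ → refl) (s , s∈T , λ _ → refl) (·1-pos 0<n) (·1-pos 0<rh)
      (reflexive (≡.cong (_· 1#) tq≡0)) (reflexive (≡.cong (_· 1#) sq≡n))
      (λ g → shift (·1-cong-+* {t g} {s g} {n} (≡.sym (s+nr≡t+nδ g))))
      wh≈rh (trans (reflexive (≡.cong (_· 1#) (≡.sym nrh≡th))) (×1-homo-* n (r h)))
      t-vertex
    where
    w : V K G
    w g = r g · 1# - δ q g · 1#
    rq≡0 : r q ≡ 0
    rq≡0 = ℕ.n≤0⇒n≡0 (≡.subst (r q ℕ.≤_) tq≡0 (r≤t q))
    h≢q : value h ≢ value q
    -- Since `r` lies below `t`, it vanishes at `q` together with `t`, whereas it is positive at
    -- `h`.
    h≢q h≡q = ℕ.<⇒≢ 0<rh (≡.sym (≡.trans (≡.cong r (G⁺-≡ h≡q)) rq≡0))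
    δh≡0 : δ q h ≡ 0
    δh≡0 = δ-≢ h≢q
    wh≈rh : w h ≈ r h · 1#
    wh≈rh rewrite δh≡0 = trans (+-congˡ -0#≈0#) (+-identityʳ _)
      where open RingProperties (CommutativeRing.ring commutativeRing) using (-0#≈0#)
    sq≡n : s q ≡ n
    sq≡n with eq ← s+nr≡t+nδ q
      rewrite rq≡0 | tq≡0 | δ-≡ {q} {q} ≡.refl | ℕ.*-zeroʳ n | ℕ.+-identityʳ (s q) | ℕ.*-identityʳ n = eq
    s∈T : s ∈ T G g₀
    s∈T = ≡.trans (total-exchange n (≡.trans Σr≡q (≡.sym (total-δ q))) s+nr≡t+nδ) Σt≡g₀
      , λ _ s≡0 → ℕ.<⇒≢ 0<n (≡.trans (≡.sym (s≡0 q)) sq≡n)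
    -- The collapse over the natural numbers. All `v q` copies of `q` are removed after the copies
    -- of `r` are added, so the subtraction is exact.
    collapseℕ : (G⁺ → ℕ) → G⁺ → ℕ
    collapseℕ v g = v g ℕ.+ v q ℕ.* r g ℕ.∸ v q ℕ.* δ q g
    collapseℕ-+ : ∀ v g → collapseℕ v g ℕ.+ v q ℕ.* δ q g ≡ v g ℕ.+ v q ℕ.* r g
    collapseℕ-+ v g = ℕ.m∸n+n≡m (ℕ.m≤n⇒m≤n+o (v q ℕ.* r g) (scaled-δ-≤ {v = v} ℕ.≤-refl g))
    -- Needed because `T` excludes the zero vector when `g₀` is zero. At `h` the collapse is
    -- `v h ℕ.+ v q ℕ.* r h`; if it vanishes then `v q` is zero, so `v` was not changed at all.
    collapseℕ-reflects-0 : ∀ v → (∀ g → collapseℕ v g ≡ 0) → ∀ g → v g ≡ 0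
    collapseℕ-reflects-0 v c≡0 g =
      ℕ.m+n≡0⇒m≡0 (v g) (≡.trans (≡.sym (collapseℕ-+ v g)) (≡.cong₂ (λ m k → m ℕ.+ k ℕ.* δ q g) (c≡0 g) vq≡0))
      where
      vq*rh≡0 : v q ℕ.* r h ≡ 0
      vq*rh≡0 = ℕ.m+n≡0⇒n≡0 (v h) (≡.trans (≡.sym (collapseℕ-+ v h))
        (≡.cong₂ ℕ._+_ (c≡0 h) (≡.trans (≡.cong (v q ℕ.*_) δh≡0) (ℕ.*-zeroʳ (v q)))))
      vq≡0 : v q ≡ 0
      vq≡0 = [ (λ p → p) , (λ rh≡0 → contradiction (≡.sym rh≡0) (ℕ.<⇒≢ 0<rh)) ]′
        (ℕ.m*n≡0⇒m≡0∨n≡0 (v q) vq*rh≡0)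
    collapse-ιT : ∀ x → x ∈ ιT K G g₀ → (λ g → x g + x q * w g) ∈ ιT K G g₀
    collapse-ιT x (v , (Σv≡g₀ , v≢0) , x≈v) = collapseℕ v
      , ( ≡.trans (total-exchange (v q) (≡.trans (total-δ q) (≡.sym Σr≡q)) (collapseℕ-+ v)) Σv≡g₀
        , λ g₀≡0 c≡0 → v≢0 g₀≡0 (collapseℕ-reflects-0 v c≡0))
      , λ g → trans (+-cong (x≈v g) (*-congʳ (x≈v q)))
          (shift (·1-cong-+* {collapseℕ v g} {v g} {v q} (collapseℕ-+ v g)))

-- The two operations as instances of the exchange.

module Operations {c ℓ₁ ℓ₂ ℓ₃ a} (K : OrderedField c ℓ₁ ℓ₂ ℓ₃) (G : FiniteAbelianGroup a)
  (g₀ : FiniteAbelianGroup.Carrier G) where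
  open FiniteAbelianGroup G
  open AbelianGroupProperties abelianGroup using (identityˡ-unique; identityʳ-unique)
  open Multiplicities G
  open VertexExchange K G g₀

  G⁺-nonzero : ∀ (g : G⁺) → value g ≢ 0#
  G⁺-nonzero record { value = v ; proof = [ v≢0 ] } v≡0 = ⊥-elim-irr (v≢0 v≡0)

  δ-≤1 : ∀ q g → δ q g ℕ.≤ 1
  δ-≤1 q g with value g ≟ value q
  ... | yes _ = s≤s z≤n
  ... | no _  = z≤n

  module _ {t} (t∈T : t ∈ T G g₀) (t-vertex : IsVertex K G (P K G g₀) (ι K G t)) where

    μ₂-adjacent : ∀ h f → Applicable₂ G t h f →
      IsVertex K G (P K G g₀) (ι K G (μ₂ G t h f))
      × Adjacent K G (P K G g₀) (ι K G t) (ι K G (μ₂ G t h f))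
    μ₂-adjacent h f ap = exchange q h (t h) t∈T t-vertex Σr≡q h∈Gₜ 0<rh nrh≡th r≤t tq≡0 balance
      where
      open Applicable₂ ap
      q : G⁺
      q = record { value = value h + value f ; proof = [ h+f≢0 ] }
      r : G⁺ → ℕ
      r g = δ h g ℕ.+ δ f g
      h≢f′ : value h ≢ value f
      h≢f′ = h≢f ∘ G⁺-≡
      -- If `h` or `f` were equal to `h + f`, the other one would be zero.
      h≢q : value h ≢ value q
      h≢q h≡q = G⁺-nonzero f (identityʳ-unique (value h) (value f) (≡.sym h≡q))
      f≢q : value f ≢ value q
      f≢q f≡q = G⁺-nonzero h (identityˡ-unique (value h) (value f) (≡.sym f≡q))
      rh≡1 : r h ≡ 1
      rh≡1 = ≡.cong₂ ℕ._+_ (δ-≡ {h} ≡.refl) (δ-≢ h≢f′)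
      0<rh : 0 ℕ.< r h
      0<rh = ≡.subst (0 ℕ.<_) (≡.sym rh≡1) (s≤s z≤n)
      nrh≡th : t h ℕ.* r h ≡ t h
      nrh≡th = ≡.trans (≡.cong (t h ℕ.*_) rh≡1) (ℕ.*-identityʳ (t h))
      Σr≡q : total r ≡ value q
      Σr≡q = ≡.trans (total-+ (δ h) (δ f)) (≡.cong₂ _+_ (total-δ h) (total-δ f))
      r≤t : ∀ g → r g ℕ.≤ t g
      r≤t g with value g ≟ value h | value g ≟ value f
      ... | yes g≡h | yes g≡f = contradiction (≡.trans (≡.sym g≡h) g≡f) h≢f′
      ... | yes g≡h | no _ rewrite G⁺-≡ {g} {h} g≡h = h∈Gₜ
      ... | no _ | yes g≡f rewrite G⁺-≡ {g} {f} g≡f = f∈Gₜ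
      ... | no _ | no _ = z≤n
      tq≡0 : t q ≡ 0
      tq≡0 = vertex-absent q h t∈T t-vertex Σr≡q r≤t 0<rh
        -- At `h` the multiset `r` has multiplicity one, while `δ q` vanishes there.
        λ rh≡δ → contradiction (≡.trans (≡.sym rh≡1) (≡.trans rh≡δ (δ-≢ h≢q))) λ ()
      balance : ∀ g → μ₂ G t h f g ℕ.+ t h ℕ.* r g ≡ t g ℕ.+ t h ℕ.* δ q g
      balance g with value g ≟ value h | value g ≟ value f | value g ≟ value h + value f
      ... | yes g≡h | yes g≡f | _ = contradiction (≡.trans (≡.sym g≡h) g≡f) h≢f′
      ... | yes g≡h | no _ | yes g≡q = contradiction (≡.trans (≡.sym g≡h) g≡q) h≢q
      ... | no _ | yes g≡f | yes g≡q = contradiction (≡.trans (≡.sym g≡f) g≡q) f≢q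
      ... | yes g≡h | no _ | no _
          rewrite G⁺-≡ {g} {h} g≡h | ℕ.*-identityʳ (t h) | ℕ.*-zeroʳ (t h) = ≡.sym (ℕ.+-identityʳ (t h))
      ... | no _ | yes g≡f | no _
          rewrite G⁺-≡ {g} {f} g≡f | ℕ.*-identityʳ (t h) | ℕ.*-zeroʳ (t h) | ℕ.+-identityʳ (t f) = ℕ.m∸n+n≡m th≤tf
      ... | no _ | no _ | yes _
          rewrite ℕ.*-identityʳ (t h) | ℕ.*-zeroʳ (t h) = ℕ.+-identityʳ _
      ... | no _ | no _ | no _ = ≡.refl

    μ₁-adjacent : ∀ h → Applicable₁ G t h →
      IsVertex K G (P K G g₀) (ι K G (μ₁ G t h))
      × Adjacent K G (P K G g₀) (ι K G t) (ι K G (μ₁ G t h))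
    μ₁-adjacent h ap = exchange {s = μ₁ G t h} q h 1 t∈T t-vertex Σr≡q (s≤s z≤n) 0<rh
        (≡.trans (ℕ.*-identityˡ (r h)) rh≡th) r≤t tq≡0 balance
      where
      open Applicable₁ ap
      q : G⁺
      q = record { value = _ ; proof = [ th·h≢0 ] }
      r : G⁺ → ℕ
      r g = t h ℕ.* δ h g
      rh≡th : r h ≡ t h
      rh≡th = ≡.trans (≡.cong (t h ℕ.*_) (δ-≡ {h} ≡.refl)) (ℕ.*-identityʳ (t h))
      0<rh : 0 ℕ.< r h
      0<rh = ≡.subst (0 ℕ.<_) (≡.sym rh≡th) h∈Gₜ
      Σr≡q : total r ≡ value q
      Σr≡q = ≡.trans (total-* (t h) (δ h)) (≡.cong (t h ·_) (total-δ h))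
        where open MonoidMult (AbelianGroup.monoid abelianGroup) renaming (_×_ to _·_)
      r≤t : ∀ g → r g ℕ.≤ t g
      r≤t = scaled-δ-≤ {v = t} ℕ.≤-refl
      tq≡0 : t q ≡ 0
      tq≡0 = vertex-absent q h t∈T t-vertex Σr≡q r≤t 0<rh
        -- Here `q` is not yet known to differ from `h`, so the multiplicities are compared by size:
        -- `r h` is `t h`, which exceeds one, and `δ q` never does.
        λ rh≡δ → ℕ.<⇒≱ th>1 (≡.subst (ℕ._≤ 1) (≡.trans (≡.sym rh≡δ) rh≡th) (δ-≤1 q h))
      balance : ∀ g → μ₁ G t h g ℕ.+ 1 ℕ.* r g ≡ t g ℕ.+ 1 ℕ.* δ q g
      balance g with value g ≟ value h | value g ≟ value q
      -- The conflicting case t(h)h = h: then `t` would vanish at `h`, as it does at `q`, although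
      -- `h` is in its support.
      ... | yes g≡h | yes g≡q = contradiction (≡.trans (≡.cong t (G⁺-≡ (≡.trans (≡.sym g≡h) g≡q))) tq≡0)
          (ℕ.<⇒≢ h∈Gₜ ∘ ≡.sym)
      ... | yes g≡h | no _
          rewrite G⁺-≡ {g} {h} g≡h | ℕ.*-identityʳ (t h) = ≡.refl
      ... | no _ | yes _ rewrite ℕ.*-zeroʳ (t h) = ℕ.+-identityʳ _
      ... | no _ | no _ rewrite ℕ.*-zeroʳ (t h) = ≡.refl

theorem3 : ∀ {c ℓ₁ ℓ₂ ℓ₃ a}
    (K : OrderedField c ℓ₁ ℓ₂ ℓ₃) (G : FiniteAbelianGroup a)
    (g₀ : FiniteAbelianGroup.Carrier G)
    (t : FiniteAbelianGroup.G⁺ G → ℕ) →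
    t ∈ T G g₀ →
    IsVertex K G (P K G g₀) (ι K G t) →
    (∀ h f → Applicable₂ G t h f →
    IsVertex K G (P K G g₀) (ι K G (μ₂ G t h f))
    × Adjacent K G (P K G g₀) (ι K G t) (ι K G (μ₂ G t h f)))
    × (∀ h → Applicable₁ G t h →
    IsVertex K G (P K G g₀) (ι K G (μ₁ G t h))
    × Adjacent K G (P K G g₀) (ι K G t) (ι K G (μ₁ G t h)))
theorem3 K G g₀ t t∈T t-vertex = μ₂-adjacent t∈T t-vertex , μ₁-adjacent t∈T t-vertex
  where open Operations K G g₀
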